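{- Let $a$ and $b$ be different positive integers with $\gcd(a,b)=1$. Then there are no positive integers $n,x$ with $n$ even such that $(a^{n}-2)(b^{n}-2)=x^{2}$. -}

module Defs where

{-# OPTIONS --safe #-}
-- Writing n = 2m and (A, B) = (aᵐ, bᵐ), it suffices to treat the equation
-- (A² − 2)(B² − 2) = x² for coprime A, B of which one is at least 2; then both are.
-- For A > B, put P = B² − 2. The element (B² − 1) − B √P of ℤ[√P] has norm 1, and
-- multiplying A √P + x by it gives A′ √P + x′ up to the sign of x′, where
-- A′ = A (B² − 1) − B x, so (A′, B) is again a solution. Moreover 0 < A′ < A and
-- A′ ≡ − A (mod B), so coprimality survives. The descent ends at A = B,
-- which forces A = 1, a contradiction.
module Submission where

open import Data.Nat using (ℕ; _<_)
open import Data.Nat.Divisibility using (_∣_)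
open import Data.Nat.GCD using (gcd)
open import Data.Integer using (+_; _-_; _*_; _^_)
open import Data.Product using (∃₂; _×_)
open import Relation.Nullary using (¬_)
open import Relation.Binary.PropositionalEquality using (_≡_; _≢_)
open import Defs

import Data.Nat as ℕ
import Data.Nat.Properties as ℕₚ
import Data.Integer as ℤ
import Data.Integer.Properties as ℤₚ
import Data.Nat.Tactic.RingSolver as ℕ-Solver
import Data.Integer.Tactic.RingSolver as ℤ-Solver
open import Data.Nat using (zero; suc; _≤_; _∸_; z≤n; s≤s)
open import Data.Nat.Coprimality as Coprimality using (Coprime; gcd≡1⇒coprime)
open import Data.Nat.Divisibility using (divides; ∣-trans; ∣-refl; ∣m∣n⇒∣m+n; ∣m+n∣m⇒∣n; ∣n⇒∣m*n; ∣m⇒∣m*n)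
open import Data.Nat.Induction using (<-wellFounded)
open import Data.Integer using (ℤ; -[1+_]; ∣_∣)
open import Data.Product using (∃-syntax; _,_)
open import Induction.WellFounded using (Acc; acc)
open import Relation.Binary.Definitions using (tri<; tri≈; tri>)
open import Relation.Nullary using (contradiction)
open import Relation.Binary.PropositionalEquality using (refl; sym; trans; cong; cong₂; subst; module ≡-Reasoning)

square-cancel-< : ∀ m n → m ℕ.* m < n ℕ.* n → m < n
square-cancel-< m n m²<n² = ℕₚ.≰⇒> λ n≤m → ℕₚ.<⇒≱ m²<n² (ℕₚ.*-mono-≤ n≤m n≤m)

coprime-*ʳ : ∀ {a b c} → Coprime a b → Coprime a c → Coprime a (b ℕ.* c)
coprime-*ʳ {a} {b} {c} a⊥b a⊥c {d} (d∣a , d∣bc) =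
  a⊥c (d∣a , Coprimality.coprime-divisor d⊥b d∣bc)
  where
  d⊥b : Coprime d b
  d⊥b (e∣d , e∣b) = a⊥b (∣-trans e∣d d∣a , e∣b)

coprime-^ʳ : ∀ {a b} m → Coprime a b → Coprime a (b ℕ.^ m)
coprime-^ʳ zero    a⊥b = Coprimality.sym (Coprimality.1-coprimeTo _)
coprime-^ʳ (suc m) a⊥b = coprime-*ʳ a⊥b (coprime-^ʳ m a⊥b)

coprime-^ : ∀ {a b} m → Coprime a b → Coprime (a ℕ.^ m) (b ℕ.^ m)
coprime-^ m a⊥b = Coprimality.sym (coprime-^ʳ m (Coprimality.sym (coprime-^ʳ m a⊥b)))

Solution : ℕ → ℕ → ℕ → Set
Solution A B x = (+ A * + A - + 2) * (+ B * + B - + 2) ≡ + x * + x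

solution-sym : ∀ {A B x} → Solution A B x → Solution B A x
solution-sym {A} {B} = trans (ℤₚ.*-comm (+ B * + B - + 2) (+ A * + A - + 2))

-- Since A² ≥ 4, the number A² - 2 is a positive natural. Naming it `suc q` lets the size estimates
-- run in ℕ without truncated subtraction.
square-split : ∀ {A} → 2 ≤ A → ∃[ q ] A ℕ.* A ≡ suc q ℕ.+ 2
square-split {A} 2≤A = A ℕ.* A ∸ 3 , trans
  (sym (ℕₚ.m∸n+n≡m {A ℕ.* A} {3} (ℕₚ.≤-trans (ℕₚ.n≤1+n 3) (ℕₚ.*-mono-≤ 2≤A 2≤A))))
  (ℕₚ.+-suc _ 2)

square-2 : ∀ {A q} → A ℕ.* A ≡ q ℕ.+ 2 → + A * + A - + 2 ≡ + q
square-2 {A} {q} A² = begin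
  + A * + A - + 2        ≡⟨ cong (_- + 2) (sym (ℤₚ.pos-* A A)) ⟩
  + (A ℕ.* A) - + 2      ≡⟨ cong (λ t → + t - + 2) A² ⟩
  + q ℤ.+ + 2 - + 2      ≡⟨ cancel (+ q) ⟩
  + q                    ∎
  where
  open ≡-Reasoning
  cancel : ∀ i → i ℤ.+ + 2 - + 2 ≡ i
  cancel = ℤ-Solver.solve-∀

-- For B = 0 or B = 1 the factor B² - 2 is negative while A² - 2 is positive, so the product is
-- negative and cannot be a square.
solution⇒2≤ : ∀ {A B x} → 2 ≤ A → Solution A B x → 2 ≤ B
solution⇒2≤ {A} {B} {x} 2≤A sol with square-split 2≤A
... | q , A² = go B (trans (cong (_* (+ B * + B - + 2)) (sym (square-2 {A} A²))) (trans sol (sym (ℤₚ.pos-* x x))))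
  where
  go : ∀ B → + suc q * (+ B * + B - + 2) ≡ + (x ℕ.* x) → 2 ≤ B
  go zero          ()
  go (suc zero)    ()
  go (suc (suc B)) _ = s≤s (s≤s z≤n)

module Descent {A B x p q : ℕ} (B<A : B < A)
  (A² : A ℕ.* A ≡ suc q ℕ.+ 2) (B² : B ℕ.* B ≡ suc p ℕ.+ 2)
  (x² : suc q ℕ.* suc p ≡ x ℕ.* x) where

  -- Here `suc p` is B² - 2, so `2 ℕ.+ p` is B² - 1. The truncation never takes effect, by
  -- `Bx<A[B²-1]`.
  A′ : ℕ
  A′ = A ℕ.* (2 ℕ.+ p) ∸ B ℕ.* x

  -- The two bounds on Bx are compared after squaring, where A², B² and x² all become polynomials in
  -- p and q.
  [Bx]² : (B ℕ.* x) ℕ.* (B ℕ.* x) ≡ (suc p ℕ.+ 2) ℕ.* (suc q ℕ.* suc p)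
  [Bx]² = trans (ℕₚ.[m*n]*[o*p]≡[m*o]*[n*p] B x B x) (cong₂ ℕ._*_ B² (sym x²))

  [An]² : ∀ n → (A ℕ.* n) ℕ.* (A ℕ.* n) ≡ (suc q ℕ.+ 2) ℕ.* (n ℕ.* n)
  [An]² n = trans (ℕₚ.[m*n]*[o*p]≡[m*o]*[n*p] A n A n) (cong (ℕ._* (n ℕ.* n)) A²)

  p<q : suc p < suc q
  p<q = ℕₚ.+-cancelʳ-< 2 (suc p) (suc q) (begin-strict
    suc p ℕ.+ 2 ≡⟨ B² ⟨
    B ℕ.* B     <⟨ ℕₚ.*-mono-< B<A B<A ⟩
    A ℕ.* A     ≡⟨ A² ⟩
    suc q ℕ.+ 2 ∎)
    where open ℕₚ.≤-Reasoning

  -- With P = B² - 2 and Q = A² - 2, the squares differ by (Q + 2)(P + 1)² - (P + 2)QP = Q + 2(P +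
  -- 1)² > 0.
  Bx<A[B²-1] : B ℕ.* x < A ℕ.* (2 ℕ.+ p)
  Bx<A[B²-1] = square-cancel-< _ _ (begin-strict
    (B ℕ.* x) ℕ.* (B ℕ.* x)                          ≡⟨ [Bx]² ⟩
    (suc p ℕ.+ 2) ℕ.* (suc q ℕ.* suc p)              <⟨ ℕₚ.m<m+n _ (s≤s z≤n) ⟩
    (suc p ℕ.+ 2) ℕ.* (suc q ℕ.* suc p) ℕ.+ suc (q ℕ.+ 2 ℕ.* ((2 ℕ.+ p) ℕ.* (2 ℕ.+ p)))
                                                     ≡⟨ expand p q ⟩
    (suc q ℕ.+ 2) ℕ.* ((2 ℕ.+ p) ℕ.* (2 ℕ.+ p))      ≡⟨ [An]² (2 ℕ.+ p) ⟨
    (A ℕ.* (2 ℕ.+ p)) ℕ.* (A ℕ.* (2 ℕ.+ p))          ∎)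
    where
    open ℕₚ.≤-Reasoning
    expand : ∀ p q → (suc p ℕ.+ 2) ℕ.* (suc q ℕ.* suc p) ℕ.+ suc (q ℕ.+ 2 ℕ.* ((2 ℕ.+ p) ℕ.* (2 ℕ.+ p)))
           ≡ (suc q ℕ.+ 2) ℕ.* ((2 ℕ.+ p) ℕ.* (2 ℕ.+ p))
    expand = ℕ-Solver.solve-∀

  -- The squares differ by (P + 2)QP - (Q + 2)P² = 2P(Q - P), which is positive because B < A. This
  -- bound is what makes A′ smaller than A.
  A[B²-2]<Bx : A ℕ.* suc p < B ℕ.* x
  A[B²-2]<Bx = square-cancel-< _ _ (begin-strict
    (A ℕ.* suc p) ℕ.* (A ℕ.* suc p)             ≡⟨ [An]² (suc p) ⟩
    (suc q ℕ.+ 2) ℕ.* (suc p ℕ.* suc p)         ≡⟨ left (suc p) (suc q) ⟩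
    (suc q ℕ.* suc p ℕ.+ 2 ℕ.* suc p) ℕ.* suc p
      <⟨ ℕₚ.*-monoˡ-< (suc p) (ℕₚ.+-monoʳ-< (suc q ℕ.* suc p) (ℕₚ.*-monoʳ-< 2 p<q)) ⟩
    (suc q ℕ.* suc p ℕ.+ 2 ℕ.* suc q) ℕ.* suc p ≡⟨ right (suc p) (suc q) ⟩
    (suc p ℕ.+ 2) ℕ.* (suc q ℕ.* suc p)         ≡⟨ [Bx]² ⟨
    (B ℕ.* x) ℕ.* (B ℕ.* x)                     ∎)
    where
    open ℕₚ.≤-Reasoning
    left : ∀ m n → (n ℕ.+ 2) ℕ.* (m ℕ.* m) ≡ (n ℕ.* m ℕ.+ 2 ℕ.* m) ℕ.* m
    left = ℕ-Solver.solve-∀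
    right : ∀ m n → (n ℕ.* m ℕ.+ 2 ℕ.* n) ℕ.* m ≡ (m ℕ.+ 2) ℕ.* (n ℕ.* m)
    right = ℕ-Solver.solve-∀

  A′+Bx : A′ ℕ.+ B ℕ.* x ≡ A ℕ.* (2 ℕ.+ p)
  A′+Bx = ℕₚ.m∸n+n≡m (ℕₚ.<⇒≤ Bx<A[B²-1])

  A′<A : A′ < A
  A′<A = ℕₚ.+-cancelʳ-< (A ℕ.* suc p) A′ A (begin-strict
    A′ ℕ.+ A ℕ.* suc p <⟨ ℕₚ.+-monoʳ-< A′ A[B²-2]<Bx ⟩
    A′ ℕ.+ B ℕ.* x     ≡⟨ A′+Bx ⟩
    A ℕ.* (2 ℕ.+ p)    ≡⟨ ℕₚ.*-suc A (suc p) ⟩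
    A ℕ.+ A ℕ.* suc p  ∎)
    where open ℕₚ.≤-Reasoning

  A′⊥B : Coprime A B → Coprime A′ B
  -- From A′ + Bx + A = AB², a common divisor of A′ and B also divides A.
  A′⊥B A⊥B {d} (d∣A′ , d∣B) = A⊥B (∣m+n∣m⇒∣n (subst (d ∣_) (sym sum≡) d∣AB²) d∣A′+Bx , d∣B)
    where
    d∣A′+Bx : d ∣ A′ ℕ.+ B ℕ.* x
    d∣A′+Bx = ∣m∣n⇒∣m+n d∣A′ (∣m⇒∣m*n x d∣B)
    d∣AB² : d ∣ A ℕ.* (B ℕ.* B)
    d∣AB² = ∣n⇒∣m*n A (∣m⇒∣m*n B d∣B)
    collect : ∀ m n → m ℕ.* (2 ℕ.+ n) ℕ.+ m ≡ m ℕ.* (suc n ℕ.+ 2)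
    collect = ℕ-Solver.solve-∀
    sum≡ : (A′ ℕ.+ B ℕ.* x) ℕ.+ A ≡ A ℕ.* (B ℕ.* B)
    sum≡ = trans (cong (ℕ._+ A) A′+Bx) (trans (collect A p) (cong (A ℕ.*_) (sym B²)))

  -- The rational part of (A √P + x)((B² - 1) - B √P). Its sign is not controlled, hence an integer
  -- whose absolute value serves as the new root.
  x′ : ℤ
  x′ = + x * (+ B * + B - + 1) - + A * + B * (+ B * + B - + 2)

  +A′ : + A′ ≡ + A * (+ B * + B - + 1) - + B * + x
  +A′ = begin
    + A′                                      ≡⟨ cancel (+ A′) (+ B * + x) ⟩
    + A′ ℤ.+ + B * + x - + B * + x            ≡⟨ cong (λ t → + A′ ℤ.+ t - + B * + x) (sym (ℤₚ.pos-* B x)) ⟩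
    + (A′ ℕ.+ B ℕ.* x) - + B * + x            ≡⟨ cong (λ t → + t - + B * + x) A′+Bx ⟩
    + (A ℕ.* (2 ℕ.+ p)) - + B * + x           ≡⟨ cong (_- + B * + x) (ℤₚ.pos-* A (2 ℕ.+ p)) ⟩
    + A * (+ 1 ℤ.+ + suc p) - + B * + x       ≡⟨ cong (λ t → + A * (+ 1 ℤ.+ t) - + B * + x) (sym (square-2 {B} B²)) ⟩
    + A * (+ 1 ℤ.+ (+ B * + B - + 2)) - + B * + x ≡⟨ shift (+ A) (+ B) (+ x) ⟩
    + A * (+ B * + B - + 1) - + B * + x       ∎
    where
    open ≡-Reasoning
    cancel : ∀ i j → i ≡ i ℤ.+ j - j
    cancel = ℤ-Solver.solve-∀
    shift : ∀ i j k → i * (+ 1 ℤ.+ (j * j - + 2)) - j * k ≡ i * (j * j - + 1) - j * k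
    shift = ℤ-Solver.solve-∀

  -- The equation says that A √P + x has norm x² - PA² = -2P. Multiplication by an element of norm 1
  -- preserves this, and `norm` is that invariance as a polynomial identity.
  solution′ : Solution A B x → Solution A′ B ∣ x′ ∣
  solution′ sol = begin
    (+ A′ * + A′ - + 2) * P                           ≡⟨ cong (λ t → (t * t - + 2) * P) +A′ ⟩
    (C * C - + 2) * P                                 ≡⟨ norm (+ A) (+ B) (+ x) ⟩
    x′ * x′ ℤ.+ ((+ A * + A - + 2) * P - + x * + x)   ≡⟨ cong (λ t → x′ * x′ ℤ.+ t) (ℤₚ.i≡j⇒i-j≡0 sol) ⟩
    x′ * x′ ℤ.+ + 0                                   ≡⟨ ℤₚ.+-identityʳ _ ⟩
    x′ * x′                                           ≡⟨ square-∣∣ x′ ⟩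
    + ∣ x′ ∣ * + ∣ x′ ∣                               ∎
    where
    open ≡-Reasoning
    P C : ℤ
    P = + B * + B - + 2
    C = + A * (+ B * + B - + 1) - + B * + x
    square-∣∣ : ∀ i → i * i ≡ + ∣ i ∣ * + ∣ i ∣
    square-∣∣ (+ n)    = refl
    square-∣∣ -[1+ n ] = refl
    norm : ∀ a b y →
      ((a * (b * b - + 1) - b * y) * (a * (b * b - + 1) - b * y) - + 2) * (b * b - + 2) ≡
      (y * (b * b - + 1) - a * b * (b * b - + 2)) * (y * (b * b - + 1) - a * b * (b * b - + 2))
        ℤ.+ ((a * a - + 2) * (b * b - + 2) - y * y)
    norm = ℤ-Solver.solve-∀

descent : ∀ {A B x} → B < A → 2 ≤ B → Coprime A B → Solution A B x →
          ∃₂ λ A′ x′ → A′ < A × Coprime A′ B × Solution A′ B x′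
descent {A} {B} {x} B<A 2≤B A⊥B sol
  with square-split (ℕₚ.≤-trans 2≤B (ℕₚ.<⇒≤ B<A)) | square-split 2≤B
... | q , A² | p , B² =
  D.A′ , ∣ D.x′ ∣ , D.A′<A , D.A′⊥B A⊥B , D.solution′ sol
  where
  -- The integer equation is carried to ℕ, where the bounds on Bx are proved.
  x² : suc q ℕ.* suc p ≡ x ℕ.* x
  x² = ℤₚ.+-injective (begin
    + (suc q ℕ.* suc p)                       ≡⟨ ℤₚ.pos-* (suc q) (suc p) ⟩
    + suc q * + suc p                         ≡⟨ cong₂ _*_ (square-2 {A} {suc q} A²) (square-2 {B} {suc p} B²) ⟨
    (+ A * + A - + 2) * (+ B * + B - + 2)     ≡⟨ sol ⟩
    + x * + x                                 ≡⟨ ℤₚ.pos-* x x ⟨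
    + (x ℕ.* x)                               ∎)
    where open ≡-Reasoning
  module D = Descent {A} {B} {x} {p} {q} B<A A² B² x²

no-solution : ∀ {A B x} → 2 ≤ A → Coprime A B → ¬ Solution A B x
no-solution {A} {B} {x} 2≤A = go {A} {B} {x} (<-wellFounded (A ℕ.+ B)) 2≤A
  where
  -- The sum is the measure because either entry may be the larger one after a step. The entry left
  -- unchanged goes first, since its bound by 2 is already known.
  go : ∀ {A B x} → Acc _<_ (A ℕ.+ B) → 2 ≤ A → Coprime A B → ¬ Solution A B x
  go {A} {B} {x} (acc rec) 2≤A A⊥B sol with ℕₚ.<-cmp A B
  ... | tri≈ _ refl _ = contradiction (A⊥B (∣-refl , ∣-refl)) (ℕₚ.>⇒≢ 2≤A)
  ... | tri> _ _ B<A =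
    let 2≤B = solution⇒2≤ {A} {B} {x} 2≤A sol
        A′ , x′ , A′<A , A′⊥B , sol′ = descent {A} {B} {x} B<A 2≤B A⊥B sol
    in go {B} {A′} {x′} (rec (subst (_< A ℕ.+ B) (ℕₚ.+-comm A′ B) (ℕₚ.+-monoˡ-< B A′<A)))
         2≤B (Coprimality.sym A′⊥B) (solution-sym {A′} {B} {x′} sol′)
  ... | tri< A<B _ _ =
    let B′ , x′ , B′<B , B′⊥A , sol′ =
          descent {B} {A} {x} A<B 2≤A (Coprimality.sym A⊥B) (solution-sym {A} {B} {x} sol)
    in go {A} {B′} {x′} (rec (ℕₚ.+-monoʳ-< A B′<B))
         2≤A (Coprimality.sym B′⊥A) (solution-sym {B′} {A} {x′} sol′)

2≤^ : ∀ {a} m → 2 ≤ a → 2 ≤ a ℕ.^ suc m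
2≤^ {a@(suc _)} m 2≤a = ℕₚ.≤-trans 2≤a (ℕₚ.m≤m*n a (a ℕ.^ m) {{ℕₚ.m^n≢0 a m}})

pos-^ : ∀ a m → + (a ℕ.^ m) ≡ (+ a) ^ m
pos-^ a zero    = refl
pos-^ a (suc m) = trans (ℤₚ.pos-* a (a ℕ.^ m)) (cong (+ a *_) (pos-^ a m))

even-power : ∀ a m → + (a ℕ.^ m) * + (a ℕ.^ m) ≡ (+ a) ^ (m ℕ.* 2)
even-power a m = begin
  + (a ℕ.^ m) * + (a ℕ.^ m)  ≡⟨ ℤₚ.pos-* (a ℕ.^ m) (a ℕ.^ m) ⟨
  + (a ℕ.^ m ℕ.* a ℕ.^ m)    ≡⟨ cong (λ t → + (a ℕ.^ m ℕ.* t)) (ℕₚ.*-identityʳ (a ℕ.^ m)) ⟨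
  + ((a ℕ.^ m) ℕ.^ 2)        ≡⟨ cong +_ (ℕₚ.^-*-assoc a m 2) ⟩
  + (a ℕ.^ (m ℕ.* 2))        ≡⟨ pos-^ a (m ℕ.* 2) ⟩
  (+ a) ^ (m ℕ.* 2)          ∎
  where open ≡-Reasoning

no-even-power-solution : ∀ a b k x → 2 ≤ a → Coprime a b →
  ((+ a) ^ (suc k ℕ.* 2) - + 2) * ((+ b) ^ (suc k ℕ.* 2) - + 2) ≢ (+ x) ^ 2
no-even-power-solution a b k x 2≤a a⊥b eq =
  no-solution {a ℕ.^ suc k} {b ℕ.^ suc k} {x} (2≤^ k 2≤a) (coprime-^ (suc k) a⊥b)
    (trans (cong₂ (λ s t → (s - + 2) * (t - + 2)) (even-power a (suc k)) (even-power b (suc k)))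
           (trans eq (cong (+ x *_) (ℤₚ.*-identityʳ (+ x)))))

theorem23 : (a b : ℕ) → 0 < a → 0 < b → a ≢ b → gcd a b ≡ 1 →
    ¬ (∃₂ λ (n x : ℕ) → 0 < n × 0 < x × 2 ∣ n ×
    ((+ a) ^ n - + 2) * ((+ b) ^ n - + 2) ≡ (+ x) ^ 2)
theorem23 a b 0<a 0<b a≢b gcd≡1 (_ , x , () , _ , divides zero refl , _)
theorem23 a b 0<a 0<b a≢b gcd≡1 (_ , x , _ , _ , divides (suc k) refl , eq)
  with gcd≡1⇒coprime {a} {b} gcd≡1 | ℕₚ.<-cmp a b
... | _   | tri≈ _ a≡b _ = a≢b a≡b
-- Of two distinct positive integers the larger is at least 2, so it is taken as the first base.
... | a⊥b | tri> _ _ b<a = no-even-power-solution a b k x (ℕₚ.≤-<-trans 0<b b<a) a⊥b eq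
... | a⊥b | tri< a<b _ _ = no-even-power-solution b a k x (ℕₚ.≤-<-trans 0<a a<b)
  (Coprimality.sym a⊥b)
  (trans (ℤₚ.*-comm ((+ b) ^ (suc k ℕ.* 2) - + 2) ((+ a) ^ (suc k ℕ.* 2) - + 2)) eq)
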